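{- For every positive integer $n$, $\hat{r}_c(nK_2,C_3)=4n-1$.
   Context: All graphs are finite and simple. $nK_2$ denotes a matching with $n$ edges, and $C_3$ denotes the triangle. For graphs $G, G_1, G_2$, write $G\to(G_1,G_2)$ if for every colouring of the edges of $G$ with red and blue, $G$ contains either a red copy of $G_1$ (all edges red) or a blue copy of $G_2$ (all edges blue). The connected size Ramsey number $\hat{r}_c(G_1,G_2)$ is the minimum number of edges of a connected graph $G$ with $G\to(G_1,G_2)$. -}

module Defs where

open import Data.Bool using (Bool; true; false; not; _∧_; if_then_else_)
open import Data.Nat using (ℕ; zero; suc; _+_; _*_; _≡ᵇ_; _<ᵇ_; _/_)
open import Data.Fin using (Fin; toℕ)
open import Data.List using (List; []; _∷_; map; length; filter; allFin; concatMap)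
open import Data.Nat.ListAction using (sum)
open import Data.Product using (Σ; _×_; _,_)
open import Relation.Binary.PropositionalEquality using (_≡_; refl)
open import Function.Definitions using (Injective)

record Graph : Set where
  field
    v     : ℕ
    adj   : Fin v → Fin v → Bool
    sym   : ∀ i j → adj i j ≡ adj j i
    irrefl : ∀ i → adj i i ≡ false
open Graph public

edges : Graph → ℕ
edges G = sum (concatMap (λ i → map (λ j → if (toℕ i <ᵇ toℕ j) ∧ adj G i j then 1 else 0)
                                    (allFin (v G)))
                         (allFin (v G)))

data Reach (G : Graph) : Fin (v G) → Fin (v G) → Set where
  here : ∀ {u} → Reach G u u
  step : ∀ {u w x} → adj G u w ≡ true → Reach G w x → Reach G u x

Connected : Graph → Set
Connected G = ∀ u w → Reach G u w

-- a red/blue colouring of the edges: a symmetric Bool-valued function on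
-- pairs of vertices (true = red, false = blue); only its values on edges matter
record Colouring (G : Graph) : Set where
  field
    col    : Fin (v G) → Fin (v G) → Bool
    colSym : ∀ i j → col i j ≡ col j i
open Colouring public

MonoCopy : (H G : Graph) → Colouring G → Bool → Set
MonoCopy H G c b =
  Σ (Fin (v H) → Fin (v G)) λ f →
    Injective _≡_ _≡_ f ×
    (∀ i j → adj H i j ≡ true → (adj G (f i) (f j) ≡ true) × (col c (f i) (f j) ≡ b))

Arrows : Graph → Graph → Graph → Set
Arrows G G₁ G₂ = (c : Colouring G) → MonoCopy G₁ G c true Data.Sum.⊎ MonoCopy G₂ G c false
  where import Data.Sum

ConnSizeRamsey : Graph → Graph → ℕ → Set
ConnSizeRamsey G₁ G₂ m =
  (Σ Graph λ G → Connected G × Arrows G G₁ G₂ × edges G ≡ m) ×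
  (∀ G → Connected G → Arrows G G₁ G₂ → m Data.Nat.≤ edges G)

≡ᵇ-sym : ∀ a b → (a ≡ᵇ b) ≡ (b ≡ᵇ a)
≡ᵇ-sym zero zero = refl
≡ᵇ-sym zero (suc b) = refl
≡ᵇ-sym (suc a) zero = refl
≡ᵇ-sym (suc a) (suc b) = ≡ᵇ-sym a b

≡ᵇ-refl : ∀ a → (a ≡ᵇ a) ≡ true
≡ᵇ-refl zero = refl
≡ᵇ-refl (suc a) = ≡ᵇ-refl a

-- the matching nK₂ on vertices 0,…,2n-1 with edges {2k, 2k+1}
matchAdj : ℕ → ℕ → Bool
matchAdj a b = ((a / 2) ≡ᵇ (b / 2)) ∧ not (a ≡ᵇ b)

nK₂ : ℕ → Graph
nK₂ n = record
  { v = 2 * n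
  ; adj = λ i j → matchAdj (toℕ i) (toℕ j)
  ; sym = λ i j → s (toℕ i) (toℕ j)
  ; irrefl = λ i → ir (toℕ i)
  }
  where
  open import Relation.Binary.PropositionalEquality using (cong₂)
  s : ∀ a b → matchAdj a b ≡ matchAdj b a
  s a b = cong₂ (λ x y → x ∧ not y) (≡ᵇ-sym (a / 2) (b / 2)) (≡ᵇ-sym a b)
  ir : ∀ a → matchAdj a a ≡ false
  ir a with (a / 2) ≡ᵇ (a / 2) | a ≡ᵇ a | ≡ᵇ-refl a
  ... | true | .true | refl = refl
  ... | false | _ | _ = refl

C₃ : Graph
C₃ = record
  { v = 3
  ; adj = λ i j → not (toℕ i ≡ᵇ toℕ j)
  ; sym = λ i j → Relation.Binary.PropositionalEquality.cong not (≡ᵇ-sym (toℕ i) (toℕ j))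
  ; irrefl = λ i → Relation.Binary.PropositionalEquality.cong not (≡ᵇ-refl (toℕ i))
  }

{-# OPTIONS --safe #-}
module Submission where

open import Defs
open import Data.Nat using (ℕ; suc; _*_; _∸_)
open import Data.Nat using (zero; _+_; _≤_; _<_; _⊓_; _≡ᵇ_; _<ᵇ_; _/_; _%_; z≤n; s≤s)
open import Data.Bool using (Bool; true; false; not; _∧_; _∨_; if_then_else_)
open import Data.Bool.Properties using (T-≡; ¬-not; ∨-comm) renaming (_≟_ to _≟ᵇ_)
open import Data.Nat.Properties hiding (_≟_)
open import Data.Nat.DivMod using (m*n/n≡m; +-distrib-/-∣ʳ; m<n*o⇒m/o<n; m≡m%n+[m/n]*n; _mod_; m%n<n)
open import Data.Nat.Divisibility using (divides-refl)
open import Data.Nat.Induction using (<-wellFounded)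
open import Data.Nat.ListAction using (sum)
open import Data.Nat.ListAction.Properties using (sum-++)
open import Data.Fin using (Fin; zero; suc; toℕ; fromℕ<; combine; _≟_)
open import Data.Fin.Properties using (any?; all?; ¬∀⟶∃¬; toℕ-injective; toℕ-fromℕ<; toℕ<n; toℕ-↑ˡ; fromℕ<-cong; fromℕ<-injective; pigeonhole; injective⇒≤; combine-injectiveˡ; combine-injectiveʳ)
open import Data.List using (List; []; _∷_; _++_; map; length; filter; allFin; tabulate; concatMap; lookup)
open import Data.List.Properties using (length-filter; filter-notAll; length-map; length-++)
open import Data.List.Membership.Propositional using (_∈_; _∉_; find; lose)
open import Data.List.Membership.Propositional.Properties using (∈-filter⁺; ∈-filter⁻; ∈-map⁺; ∈-map⁻; ∈-allFin; ∈-++⁺ˡ; ∈-++⁺ʳ; ∈-++⁻; ∈-concatMap⁺; ∈-concatMap⁻; ∈-lookup)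
import Data.List.Membership.DecPropositional as DecMembership
open import Data.List.Relation.Unary.All using (All; []; _∷_)
import Data.List.Relation.Unary.All as All
open import Data.List.Relation.Unary.All.Properties using (¬All⇒Any¬; All¬⇒¬Any)
open import Data.List.Relation.Unary.Any using (Any; here; there)
import Data.List.Relation.Unary.Any as Any
open import Data.List.Relation.Unary.Any.Properties using (lookup-index)
open import Data.List.Relation.Unary.AllPairs using ([]; _∷_)
open import Data.List.Relation.Unary.Unique.Propositional using (Unique)
import Data.List.Relation.Unary.Unique.Propositional.Properties as Unique
open import Data.Product using (∃; ∃₂; _×_; _,_; proj₁; proj₂)
open import Data.Product.Properties using (≡-dec)
open import Data.Sum using (_⊎_; inj₁; inj₂; [_,_]′)
import Data.Sum as Sum
open import Function using (_∘_; id; case_of_; mk⇔; Equivalence)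
open import Induction.WellFounded using (Acc; acc)
open import Relation.Nullary using (¬_; Dec; yes; no; ¬?; does; contradiction)
open import Relation.Nullary.Decidable using (_×-dec_; _⊎-dec_; does-⇔)
open import Relation.Binary.Definitions using (tri<; tri≈; tri>)
open import Relation.Binary.PropositionalEquality using (_≡_; _≢_; refl; cong; cong₂; subst; subst₂; module ≡-Reasoning) renaming (sym to ≡-sym; trans to ≡-trans)

-- Upper bound: n + 1 disjoint triangles joined in a row by n edges.
--
-- Lower bound: a set of edges covered by m pieces, each a star or a triangle,
-- contains no matching of m + 1 edges, so it suffices to meet all triangles of a
-- graph with e edges and r nontrivial components by m pieces with 4 m ≤ e + r.  Induct on e.
-- An edge in no triangle can be deleted, since then r grows by at most one.
-- Otherwise take a non-cut vertex c.  If it has degree at least 4, use its star.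
-- If its neighbours are a and b, use the star of a or b: either one of them lies in
-- a further triangle, or abc is a component.  If it has three neighbours,
-- use the star of the middle one when they induce a path, and the triangle they
-- form otherwise.  In each case deleting the piece together with the edges
-- at c lowers e + r by at least 4.
--
-- Components are tracked by a list L of roots and a height h such that every
-- non-isolated vertex is a root or has a lower neighbour; then r ≤ |L|, and a
-- highest vertex is a non-cut vertex.

-- Edge lists and deletion of edges

module _ {N : ℕ} where

  private
    V : Set
    V = Fin N

    open DecMembership (≡-dec (_≟_ {N}) (_≟_ {N})) using () renaming (_∈?_ to _∈ᵉ?_)
    open DecMembership (_≟_ {N}) using (_∈?_)

  EdgeList : Set
  EdgeList = List (V × V)

  Adj : EdgeList → V → V → Set
  Adj E x y = (x , y) ∈ E ⊎ (y , x) ∈ E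

  Adj? : ∀ E x y → Dec (Adj E x y)
  Adj? E x y = ((x , y) ∈ᵉ? E) ⊎-dec ((y , x) ∈ᵉ? E)

  Adj-sym : ∀ {E x y} → Adj E x y → Adj E y x
  Adj-sym = Sum.swap

  neighbours : EdgeList → V → List V
  neighbours E x = filter (Adj? E x) (allFin N)

  ∈-neighbours⁺ : ∀ {E x y} → Adj E x y → y ∈ neighbours E x
  ∈-neighbours⁺ {E} {x} {y} = ∈-filter⁺ (Adj? E x) (∈-allFin y)

  ∈-neighbours⁻ : ∀ {E x y} → y ∈ neighbours E x → Adj E x y
  ∈-neighbours⁻ {E} {x} m = proj₂ (∈-filter⁻ (Adj? E x) {xs = allFin N} m)

  neighbours-unique : ∀ E x → Unique (neighbours E x)
  neighbours-unique E x = Unique.filter⁺ (Adj? E x) (Unique.allFin⁺ N)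

  Between : V → List V → V → V → Set
  Between c zs x y = (x ≡ c × y ∈ zs) ⊎ (y ≡ c × x ∈ zs)

  private
    survives? : ∀ c z (e : V × V) → Dec (¬ (e ≡ (c , z) ⊎ e ≡ (z , c)))
    survives? c z e = ¬? (≡-dec _≟_ _≟_ e (c , z) ⊎-dec ≡-dec _≟_ _≟_ e (z , c))

  delete : V → List V → EdgeList → EdgeList
  delete c []       E = E
  delete c (z ∷ zs) E = filter (survives? c z) (delete c zs E)

  delete-⊆ : ∀ c zs {E x y} → Adj (delete c zs E) x y → Adj E x y
  delete-⊆ c []       a        = a
  delete-⊆ c (z ∷ zs) (inj₁ m) = delete-⊆ c zs (inj₁ (proj₁ (∈-filter⁻ (survives? c z) m)))
  delete-⊆ c (z ∷ zs) (inj₂ m) = delete-⊆ c zs (inj₂ (proj₁ (∈-filter⁻ (survives? c z) m)))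

  delete-kept : ∀ c zs {E x y} → Adj E x y → Adj (delete c zs E) x y ⊎ Between c zs x y
  delete-kept c []       a = inj₁ a
  delete-kept c (z ∷ zs) {E} {x} {y} a with delete-kept c zs a
  ... | inj₂ (inj₁ (p , q)) = inj₂ (inj₁ (p , there q))
  ... | inj₂ (inj₂ (p , q)) = inj₂ (inj₂ (p , there q))
  ... | inj₁ (inj₁ m) with survives? c z (x , y)
  ...   | yes s = inj₁ (inj₁ (∈-filter⁺ (survives? c z) m s))
  ...   | no ¬s with ≡-dec _≟_ _≟_ (x , y) (c , z) | ≡-dec _≟_ _≟_ (x , y) (z , c)
  ...     | yes refl | _        = inj₂ (inj₁ (refl , here refl))
  ...     | no _     | yes refl = inj₂ (inj₂ (refl , here refl))
  ...     | no p     | no q     = contradiction [ p , q ]′ ¬s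
  delete-kept c (z ∷ zs) {E} {x} {y} a | inj₁ (inj₂ m) with survives? c z (y , x)
  ...   | yes s = inj₁ (inj₂ (∈-filter⁺ (survives? c z) m s))
  ...   | no ¬s with ≡-dec _≟_ _≟_ (y , x) (c , z) | ≡-dec _≟_ _≟_ (y , x) (z , c)
  ...     | yes refl | _        = inj₂ (inj₂ (refl , here refl))
  ...     | no _     | yes refl = inj₂ (inj₁ (refl , here refl))
  ...     | no p     | no q     = contradiction [ p , q ]′ ¬s

  delete-gone : ∀ c zs {E z} → z ∈ zs → ¬ Adj (delete c zs E) c z
  delete-gone c (z ∷ zs) {E} (here refl) (inj₁ m) =
    proj₂ (∈-filter⁻ (survives? c z) {xs = delete c zs E} m) (inj₁ refl)
  delete-gone c (z ∷ zs) {E} (here refl) (inj₂ m) =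
    proj₂ (∈-filter⁻ (survives? c z) {xs = delete c zs E} m) (inj₂ refl)
  delete-gone c (z ∷ zs) {E} (there p) (inj₁ m) =
    delete-gone c zs p (inj₁ (proj₁ (∈-filter⁻ (survives? c z) {xs = delete c zs E} m)))
  delete-gone c (z ∷ zs) {E} (there p) (inj₂ m) =
    delete-gone c zs p (inj₂ (proj₁ (∈-filter⁻ (survives? c z) {xs = delete c zs E} m)))

  delete-≤ : ∀ c zs E → length (delete c zs E) ≤ length E
  delete-≤ c []       E = ≤-refl
  delete-≤ c (z ∷ zs) E = ≤-trans (length-filter (survives? c z) (delete c zs E)) (delete-≤ c zs E)

  -- The edge from `c` to `z` is still present when its turn comes, because the other deletions
  -- concern vertices different from `z`; so every filter drops at least one entry. An edge list may
  -- repeat an edge, hence only an inequality.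
  delete-length : ∀ c zs {E} → Unique zs → (∀ {z} → z ∈ zs → Adj E c z) →
                  length (delete c zs E) + length zs ≤ length E
  delete-length c []       _        nbr = ≤-reflexive (+-identityʳ _)
  delete-length c (z ∷ zs) {E} (z∉ ∷ u) nbr = begin
      length (delete c (z ∷ zs) E) + suc (length zs) ≡⟨ +-suc _ _ ⟩
      suc (length (delete c (z ∷ zs) E)) + length zs ≤⟨ +-monoˡ-≤ (length zs) shorter ⟩
      length (delete c zs E) + length zs             ≤⟨ delete-length c zs u (nbr ∘ there) ⟩
      length E                                       ∎
    where
    open ≤-Reasoning
    kept : Adj (delete c zs E) c z
    kept with delete-kept c zs (nbr (here refl))
    ... | inj₁ a                = a
    ... | inj₂ (inj₁ (_ , m))   = contradiction m (All¬⇒¬Any z∉)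
    ... | inj₂ (inj₂ (refl , m)) = contradiction m (All¬⇒¬Any z∉)
    doomed : Adj (delete c zs E) c z → Any (λ e → ¬ ¬ (e ≡ (c , z) ⊎ e ≡ (z , c))) (delete c zs E)
    doomed (inj₁ m) = lose m (λ s → s (inj₁ refl))
    doomed (inj₂ m) = lose m (λ s → s (inj₂ refl))
    shorter : length (delete c (z ∷ zs) E) < length (delete c zs E)
    shorter = filter-notAll (survives? c z) (delete c zs E) (doomed kept)

  delete-bound : ∀ c zs {E} l → Unique zs → (∀ {z} → z ∈ zs → Adj E c z) →
                 length (delete c zs E) + l + length zs ≤ length E + l
  delete-bound c zs {E} l uniq nbr = begin
    length (delete c zs E) + l + length zs   ≡⟨ +-assoc (length (delete c zs E)) l _ ⟩
    length (delete c zs E) + (l + length zs) ≡⟨ cong (length (delete c zs E) +_) (+-comm l _) ⟩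
    length (delete c zs E) + (length zs + l) ≡⟨ +-assoc (length (delete c zs E)) _ l ⟨
    length (delete c zs E) + length zs + l   ≤⟨ +-monoˡ-≤ l (delete-length c zs uniq nbr) ⟩
    length E + l                             ∎
    where open ≤-Reasoning

  -- Roots and heights

  Rooted : EdgeList → List V → (V → ℕ) → Set
  Rooted E L h = ∀ {u w} → Adj E u w → u ∈ L ⊎ ∃ λ p → Adj E u p × h p < h u

  -- No vertex of `zs` descends through `c`, which is at least as high. So only `c` can lose its
  -- lower neighbour, and it is made a root. `E′` is left abstract so that the deletion may be
  -- written from either end of an edge.
  rooted-cut : ∀ {E E′ L h} c zs → (∀ {x y} → Adj E′ x y → Adj E x y) →
               (∀ {x y} → Adj E x y → Adj E′ x y ⊎ Between c zs x y) →
               (∀ {z} → z ∈ zs → h z ≤ h c) → Rooted E L h → Rooted E′ (c ∷ L) h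
  rooted-cut c zs sub kept low r {u} a with u ≟ c
  ... | yes refl = inj₁ (here refl)
  ... | no u≢c with r (sub a)
  ...   | inj₁ u∈L = inj₁ (there u∈L)
  ...   | inj₂ (p , up , lt) with kept up
  ...     | inj₁ up′                = inj₂ (p , up′ , lt)
  ...     | inj₂ (inj₁ (eq , _))    = contradiction eq u≢c
  ...     | inj₂ (inj₂ (refl , u∈)) = contradiction lt (≤⇒≯ (low u∈))

  rooted-∷⁻ : ∀ {E L h c} → (∀ {w} → ¬ Adj E c w) → Rooted E (c ∷ L) h → Rooted E L h
  rooted-∷⁻ iso r a with r a
  ... | inj₁ (here refl) = contradiction a iso
  ... | inj₁ (there m)   = inj₁ m
  ... | inj₂ s           = inj₂ s

  without : V → List V → List V
  without c = filter (λ u → ¬? (u ≟ c))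

  rooted-without : ∀ {E L h c} → (∀ {w} → ¬ Adj E c w) → Rooted E L h → Rooted E (without c L) h
  rooted-without {c = c} iso r {u} a with u ≟ c
  ... | yes refl = contradiction a iso
  ... | no u≢c   = Sum.map₁ (λ m → ∈-filter⁺ (λ w → ¬? (w ≟ c)) m u≢c) (r a)

  -- Pieces, states and steps

  data Piece : Set where
    star     : V → Piece
    triangle : V → V → V → Piece

  Hit : Piece → V → V → Set
  Hit (star c)         x y = x ≡ c ⊎ y ≡ c
  Hit (triangle a b c) x y = x ∈ (a ∷ b ∷ c ∷ []) × y ∈ (a ∷ b ∷ c ∷ [])

  Hit? : ∀ p x y → Dec (Hit p x y)
  Hit? (star c)         x y = (x ≟ c) ⊎-dec (y ≟ c)
  Hit? (triangle a b c) x y = (x ∈? _) ×-dec (y ∈? _)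

  Hit-sym : ∀ p {x y} → Hit p x y → Hit p y x
  Hit-sym (star c)         = Sum.swap
  Hit-sym (triangle a b c) (m , n) = n , m

  record State : Set where
    field
      E        : EdgeList
      L        : List V
      h        : V → ℕ
      rooted   : Rooted E L h
      loopless : ∀ {x} → ¬ Adj E x x

    potential : ℕ
    potential = length E + length L

  open State

  -- `k` is the guaranteed drop of the potential. `kept` speaks of edges rather than triangles: an
  -- edge may vanish only if `p` hits it.
  record Step (S : State) (k : ℕ) (p : Piece) : Set where
    field
      next    : State
      sub     : ∀ {x y} → Adj (E next) x y → Adj (E S) x y
      kept    : ∀ {x y} → Adj (E S) x y → Adj (E next) x y ⊎ Hit p x y
      shorter : length (E next) ≤ length (E S)
      bound   : potential next + k ≤ potential S

  open Step

  kept-away : ∀ {S c k x y} (T : Step S k (star c)) → x ≢ c → y ≢ c → Adj (E S) x y → Adj (E (next T)) x y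
  kept-away T x≢c y≢c a with kept T a
  ... | inj₁ a′       = a′
  ... | inj₂ (inj₁ e) = contradiction e x≢c
  ... | inj₂ (inj₂ e) = contradiction e y≢c

  between⇒hit : ∀ c zs {x y} → Between c zs x y → Hit (star c) x y
  between⇒hit c zs = Sum.map proj₁ proj₁

  -- Only the higher end of an edge can use it to descend, so cutting the edge
  -- costs at most one new root.
  cut-edges : ∀ S c zs → ∃ λ L′ → Rooted (delete c zs (E S)) L′ (h S) ×
              length (delete c zs (E S)) + length L′ ≤ potential S
  cut-edges S c [] = L S , rooted S , ≤-refl
  cut-edges S c (z ∷ zs) with cut-edges S c zs | Adj? (delete c zs (E S)) c z
  -- Here `z` is not joined to `c`, so the adjacency relation does not change and no root is added.
  ... | L₁ , r₁ , b₁ | no ¬a = L₁ ,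
        (λ a → Sum.map₂ (λ (p , up , lt) → p , back up , lt) (r₁ (delete-⊆ c (z ∷ []) a))) ,
        ≤-trans (+-monoˡ-≤ _ (delete-≤ c (z ∷ []) (delete c zs (E S)))) b₁
    where
    back : ∀ {x y} → Adj (delete c zs (E S)) x y → Adj (delete c (z ∷ zs) (E S)) x y
    back a with delete-kept c (z ∷ []) a
    ... | inj₁ a′ = a′
    ... | inj₂ (inj₁ (refl , here refl)) = contradiction a ¬a
    ... | inj₂ (inj₂ (refl , here refl)) = contradiction (Adj-sym a) ¬a
  ... | L₁ , r₁ , b₁ | yes a = higher (≤-total (h S z) (h S c))
    where
    E₁ E₂ : EdgeList
    E₁ = delete c zs (E S)
    E₂ = delete c (z ∷ []) E₁
    bound₂ : length E₂ + suc (length L₁) ≤ potential S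
    bound₂ = begin
      length E₂ + suc (length L₁)   ≡⟨ +-assoc (length E₂) 1 _ ⟨
      length E₂ + 1 + length L₁     ≤⟨ +-monoˡ-≤ _ (delete-length c (z ∷ []) ([] ∷ []) λ { (here refl) → a }) ⟩
      length E₁ + length L₁         ≤⟨ b₁ ⟩
      potential S                   ∎
      where open ≤-Reasoning
    flip : ∀ {x y} → Between c (z ∷ []) x y → Between z (c ∷ []) x y
    flip (inj₁ (refl , here refl)) = inj₂ (refl , here refl)
    flip (inj₂ (refl , here refl)) = inj₁ (refl , here refl)
    higher : h S z ≤ h S c ⊎ h S c ≤ h S z →
             ∃ λ L′ → Rooted E₂ L′ (h S) × length E₂ + length L′ ≤ potential S
    higher (inj₁ le) = c ∷ L₁ ,
      rooted-cut c (z ∷ []) (delete-⊆ c (z ∷ [])) (delete-kept c (z ∷ []))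
        (λ { (here refl) → le }) r₁ , bound₂
    higher (inj₂ le) = z ∷ L₁ ,
      rooted-cut z (c ∷ []) (delete-⊆ c (z ∷ [])) (Sum.map₂ flip ∘ delete-kept c (z ∷ []))
        (λ { (here refl) → le }) r₁ , bound₂

  cut : State → V → List V → State
  cut S c zs = record
    { E = delete c zs (E S) ; L = proj₁ (cut-edges S c zs) ; h = h S
    ; rooted = proj₁ (proj₂ (cut-edges S c zs)) ; loopless = loopless S ∘ delete-⊆ c zs }

  cut-bound : ∀ S c zs → potential (cut S c zs) ≤ potential S
  cut-bound S c zs = proj₂ (proj₂ (cut-edges S c zs))

  -- If b is adjacent to all other neighbours of c, then b can take the place of c
  -- in the tree structure, at the lower of the two heights.
  contract : ∀ S c b xs → Unique xs → (∀ {w} → w ∈ xs → Adj (E S) c w) →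
             (∀ {w} → Adj (E S) c w → w ∈ xs) → b ∈ xs →
             (∀ {w} → w ∈ xs → w ≡ b ⊎ Adj (E S) w b) → Step S (length xs) (star c)
  contract S c b xs uniq adj⁻ adj⁺ b∈xs dom = record
    { next = record { E = E′ ; L = L′ ; h = h′ ; rooted = rooted′ ; loopless = loopless S ∘ delete-⊆ c xs }
    ; sub = delete-⊆ c xs
    ; kept = Sum.map₂ (between⇒hit c xs) ∘ delete-kept c xs
    ; shorter = delete-≤ c xs (E S)
    ; bound = bound′ }
    where
    E′ : EdgeList
    E′ = delete c xs (E S)
    -- If `c` is a root, `b` inherits this, so the length of the list of roots stays the same.
    rename : V → V
    rename u with u ≟ c
    ... | yes _ = b
    ... | no _  = u
    L′ : List V
    L′ = map rename (L S)
    h′ : V → ℕ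
    h′ u with u ≟ b
    ... | yes _ = h S b ⊓ h S c
    ... | no _  = h S u
    bound′ : length E′ + length L′ + length xs ≤ potential S
    bound′ = subst (λ l → length E′ + l + length xs ≤ potential S) (≡-sym (length-map rename (L S)))
               (delete-bound c xs (length (L S)) uniq adj⁻)
    c≢b : c ≢ b
    c≢b refl = loopless S (adj⁻ b∈xs)
    gone : ∀ {w} → ¬ Adj E′ c w
    gone a = delete-gone c xs (adj⁺ (delete-⊆ c xs a)) a
    still : ∀ {x y} → x ≢ c → y ≢ c → Adj (E S) x y → Adj E′ x y
    still x≢c y≢c a with delete-kept c xs a
    ... | inj₁ a′              = a′
    ... | inj₂ (inj₁ (eq , _)) = contradiction eq x≢c
    ... | inj₂ (inj₂ (eq , _)) = contradiction eq y≢c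
    ∈L′ : ∀ {u} → u ≢ c → u ∈ L S → u ∈ L′
    ∈L′ {u} u≢c m = subst (_∈ L′) eq (∈-map⁺ rename m)
      where
      eq : rename u ≡ u
      eq with u ≟ c
      ... | yes u≡c = contradiction u≡c u≢c
      ... | no _    = refl
    b∈L′ : c ∈ L S → b ∈ L′
    b∈L′ m = subst (_∈ L′) eq (∈-map⁺ rename m)
      where
      eq : rename c ≡ b
      eq with c ≟ c
      ... | yes _  = refl
      ... | no c≢c = contradiction refl c≢c
    h′b : h′ b ≡ h S b ⊓ h S c
    h′b with b ≟ b
    ... | yes _  = refl
    ... | no b≢b = contradiction refl b≢b
    h′-≢ : ∀ {u} → u ≢ b → h′ u ≡ h S u
    h′-≢ {u} u≢b with u ≟ b
    ... | yes eq = contradiction eq u≢b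
    ... | no _   = refl
    h′≤h : ∀ u → h′ u ≤ h S u
    h′≤h u with u ≟ b
    ... | yes refl = m⊓n≤m (h S b) (h S c)
    ... | no _     = ≤-refl
    b-rooted : b ∈ L′ ⊎ ∃ λ p → Adj E′ b p × h′ p < h′ b
    b-rooted with ≤-total (h S b) (h S c)
    -- `b` keeps its height. A lower neighbour of `b` lies strictly below `c` as well, so it is not
    -- `c` and its edge to `b` survives.
    b-rooted | inj₁ le with rooted S (Adj-sym (adj⁻ b∈xs))
    ... | inj₁ m = inj₁ (∈L′ (c≢b ∘ ≡-sym) m)
    ... | inj₂ (p , bp , lt) = inj₂ (p , still (c≢b ∘ ≡-sym) p≢c bp ,
            ≤-<-trans (h′≤h p) (<-≤-trans lt (≤-reflexive (≡-sym (≡-trans h′b (m≤n⇒m⊓n≡m le))))))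
      where
      p≢c : p ≢ c
      p≢c refl = <⇒≱ lt le
    -- `b` drops to the height of `c` and takes over its descent: a lower neighbour `p` of `c`
    -- belongs to `xs` and is not `b`, since `b` is at least as high as `c`; so `p` is adjacent to
    -- `b`.
    b-rooted | inj₂ ge with rooted S (adj⁻ b∈xs)
    ... | inj₁ m = inj₁ (b∈L′ m)
    ... | inj₂ (p , cp , lt) with dom (adj⁺ cp)
    ...   | inj₁ refl = contradiction lt (≤⇒≯ ge)
    ...   | inj₂ pb = inj₂ (p , still (c≢b ∘ ≡-sym) p≢c (Adj-sym pb) ,
              ≤-<-trans (h′≤h p) (<-≤-trans lt (≤-reflexive (≡-sym (≡-trans h′b (m≥n⇒m⊓n≡n ge))))))
      where
      p≢c : p ≢ c
      p≢c refl = loopless S cp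
    other-rooted : ∀ {u w} → u ≢ b → Adj E′ u w → u ∈ L′ ⊎ ∃ λ p → Adj E′ u p × h′ p < h S u
    other-rooted u≢b a with rooted S (delete-⊆ c xs a)
    ... | inj₁ m = inj₁ (∈L′ (λ { refl → gone a }) m)
    ... | inj₂ (p , up , lt) with p ≟ c
    ...   | no p≢c = inj₂ (p , still (λ { refl → gone a }) p≢c up , ≤-<-trans (h′≤h p) lt)
    -- A descent through `c` is rerouted through `b`, whose new height is at most that of `c`.
    ...   | yes refl with dom (adj⁺ (Adj-sym up))
    ...     | inj₁ eq = contradiction eq u≢b
    ...     | inj₂ ub = inj₂ (b , still (λ { refl → gone a }) (c≢b ∘ ≡-sym) ub ,
                ≤-<-trans (≤-trans (≤-reflexive h′b) (m⊓n≤n (h S b) (h S c))) lt)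
    rooted′ : Rooted E′ L′ h′
    rooted′ {u} a = case u ≟ b of λ where
      (yes refl) → b-rooted
      (no u≢b)   → Sum.map₂ (λ (p , up , lt) → p , up , subst (h′ p <_) (≡-sym (h′-≢ u≢b)) lt) (other-rooted u≢b a)

  -- `contract` wants `xs` to contain all neighbours of `c`. The other edges at `c` are therefore
  -- removed first by `cut`, which does not raise the potential. This serves for a vertex of unknown
  -- degree of which only a few neighbours are known to be joined to `b`; only these count towards
  -- the gain.
  isolate : ∀ S c b xs → Unique xs → (∀ {w} → w ∈ xs → Adj (E S) c w) → b ∈ xs →
            (∀ {w} → w ∈ xs → w ≡ b ⊎ Adj (E S) w b) → Step S (length xs) (star c)
  isolate S c b xs uniq adj⁻ b∈xs dom = record
    { next = next T ; sub = delete-⊆ c zs ∘ sub T ; kept = kept′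
    ; shorter = ≤-trans (shorter T) (delete-≤ c zs (E S))
    ; bound = ≤-trans (bound T) (cut-bound S c zs) }
    where
    zs : List V
    zs = filter (λ w → ¬? (w ∈? xs)) (neighbours (E S) c)
    zs∉ : ∀ {w} → w ∈ zs → w ∉ xs
    zs∉ m = proj₂ (∈-filter⁻ (λ w → ¬? (w ∈? xs)) {xs = neighbours (E S) c} m)
    c∉zs : c ∉ zs
    c∉zs m = loopless S (∈-neighbours⁻ {E S} (proj₁ (∈-filter⁻ (λ w → ¬? (w ∈? xs)) m)))
    adj₁ : ∀ {w} → w ∈ xs → Adj (delete c zs (E S)) c w
    adj₁ m with delete-kept c zs (adj⁻ m)
    ... | inj₁ a = a
    ... | inj₂ (inj₁ (_ , n)) = contradiction m (zs∉ n)
    ... | inj₂ (inj₂ (_ , n)) = contradiction n c∉zs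
    adj₂ : ∀ {w} → Adj (delete c zs (E S)) c w → w ∈ xs
    adj₂ {w} a with w ∈? xs
    ... | yes m = m
    ... | no w∉ = contradiction a (delete-gone c zs (∈-filter⁺ (λ w → ¬? (w ∈? xs)) (∈-neighbours⁺ {E S} (delete-⊆ c zs a)) w∉))
    c∉xs : c ∉ xs
    c∉xs m = loopless S (adj⁻ m)
    dom₁ : ∀ {w} → w ∈ xs → w ≡ b ⊎ Adj (delete c zs (E S)) w b
    dom₁ m with dom m
    ... | inj₁ eq = inj₁ eq
    ... | inj₂ a with delete-kept c zs a
    ...   | inj₁ a′ = inj₂ a′
    ...   | inj₂ (inj₁ (refl , _)) = contradiction m c∉xs
    ...   | inj₂ (inj₂ (refl , _)) = contradiction b∈xs c∉xs
    T : Step (cut S c zs) (length xs) (star c)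
    T = contract (cut S c zs) c b xs uniq adj₁ adj₂ b∈xs dom₁
    kept′ : ∀ {x y} → Adj (E S) x y → Adj (E (next T)) x y ⊎ Hit (star c) x y
    kept′ a with delete-kept c zs a
    ... | inj₁ a′ = kept T a′
    ... | inj₂ bt = inj₂ (between⇒hit c zs bt)

  -- A vertex that is nowhere the lower neighbour of another one can be isolated
  -- without creating roots.
  isolate-top : ∀ (S : State) c xs → Unique xs → (∀ {w} → w ∈ xs → Adj (E S) c w) →
                (∀ {w} → Adj (E S) c w → w ∈ xs) → (∀ {w} → w ∈ xs → h S w ≤ h S c) →
                Step S (length xs) (star c)
  isolate-top S c xs uniq adj⁻ adj⁺ low = record
    { next = record
        { E = delete c xs (E S) ; L = L S ; h = h S
        ; rooted = rooted-∷⁻ (λ a → delete-gone c xs (adj⁺ (delete-⊆ c xs a)) a)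
                     (rooted-cut c xs (delete-⊆ c xs) (delete-kept c xs) low (rooted S))
        ; loopless = loopless S ∘ delete-⊆ c xs }
    ; sub = delete-⊆ c xs
    ; kept = Sum.map₂ (between⇒hit c xs) ∘ delete-kept c xs
    ; shorter = delete-≤ c xs (E S)
    ; bound = delete-bound c xs (length (L S)) uniq adj⁻ }

  weaken : ∀ {S : State} {k p q} → (∀ {x y} → Hit p x y → Hit q x y) → Step S k p → Step S k q
  weaken f T = record
    { next = next T ; sub = sub T ; kept = Sum.map₂ f ∘ kept T ; shorter = shorter T ; bound = bound T }

  -- The two edges at the highest corner `c` together cost one root, namely `c`, and the edge `ab`
  -- costs at most one more. Three edges against two roots leave a gain of 1.
  cut-triangle-top : ∀ (S : State) a b c → Adj (E S) a b → Adj (E S) b c → Adj (E S) a c →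
                     h S a ≤ h S c → h S b ≤ h S c → Step S 1 (triangle a b c)
  cut-triangle-top S a b c ab bc ac a≤c b≤c = record
    { next = cut S₁ a (b ∷ [])
    ; sub = delete-⊆ c (a ∷ b ∷ []) ∘ delete-⊆ a (b ∷ [])
    ; kept = kept′
    ; shorter = ≤-trans (delete-≤ a (b ∷ []) (E S₁)) (delete-≤ c (a ∷ b ∷ []) (E S))
    ; bound = bound′ }
    where
    low : ∀ {z} → z ∈ (a ∷ b ∷ []) → h S z ≤ h S c
    low (here refl)         = a≤c
    low (there (here refl)) = b≤c
    nbr : ∀ {z} → z ∈ (a ∷ b ∷ []) → Adj (E S) c z
    nbr (here refl)         = Adj-sym ac
    nbr (there (here refl)) = Adj-sym bc
    a≢b : a ≢ b
    a≢b refl = loopless S ab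
    S₁ : State
    S₁ = record
      { E = delete c (a ∷ b ∷ []) (E S) ; L = c ∷ L S ; h = h S
      ; rooted = rooted-cut c (a ∷ b ∷ []) (delete-⊆ c (a ∷ b ∷ [])) (delete-kept c (a ∷ b ∷ [])) low (rooted S)
      ; loopless = loopless S ∘ delete-⊆ c (a ∷ b ∷ []) }
    bound′ : potential (cut S₁ a (b ∷ [])) + 1 ≤ potential S
    bound′ = begin
      potential (cut S₁ a (b ∷ [])) + 1                ≤⟨ +-monoˡ-≤ 1 (cut-bound S₁ a (b ∷ [])) ⟩
      length (E S₁) + (1 + length (L S)) + 1           ≡⟨ +-assoc (length (E S₁)) _ _ ⟩
      length (E S₁) + suc (length (L S) + 1)           ≡⟨ cong (λ l → length (E S₁) + suc l) (+-comm (length (L S)) 1) ⟩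
      length (E S₁) + (2 + length (L S))               ≡⟨ +-assoc (length (E S₁)) 2 _ ⟨
      length (E S₁) + 2 + length (L S)                 ≤⟨ +-monoˡ-≤ _ (delete-length c (a ∷ b ∷ []) ((a≢b ∷ []) ∷ [] ∷ []) nbr) ⟩
      potential S                                      ∎
      where open ≤-Reasoning
    kept′ : ∀ {x y} → Adj (E S) x y → Adj (E (cut S₁ a (b ∷ []))) x y ⊎ Hit (triangle a b c) x y
    kept′ e with delete-kept c (a ∷ b ∷ []) e
    ... | inj₂ (inj₁ (refl , here refl))         = inj₂ (there (there (here refl)) , here refl)
    ... | inj₂ (inj₁ (refl , there (here refl))) = inj₂ (there (there (here refl)) , there (here refl))
    ... | inj₂ (inj₂ (refl , here refl))         = inj₂ (here refl , there (there (here refl)))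
    ... | inj₂ (inj₂ (refl , there (here refl))) = inj₂ (there (here refl) , there (there (here refl)))
    ... | inj₁ e₁ with delete-kept a (b ∷ []) e₁
    ...   | inj₁ e₂ = inj₁ e₂
    ...   | inj₂ (inj₁ (refl , here refl)) = inj₂ (here refl , there (here refl))
    ...   | inj₂ (inj₂ (refl , here refl)) = inj₂ (there (here refl) , here refl)

  rotate : ∀ {a b c x y : V} → Hit (triangle a b c) x y → Hit (triangle b c a) x y
  rotate {a} {b} {c} (m , n) = shift m , shift n
    where
    shift : ∀ {u} → u ∈ (a ∷ b ∷ c ∷ []) → u ∈ (b ∷ c ∷ a ∷ [])
    shift (here e)                 = there (there (here e))
    shift (there (here e))         = here e
    shift (there (there (here e))) = there (here e)

  -- The case split finds a highest corner and passes it last; `rotate` restores the order of the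
  -- corners in the piece.
  cut-triangle : ∀ (S : State) a b c → Adj (E S) a b → Adj (E S) b c → Adj (E S) a c →
                 Step S 1 (triangle a b c)
  cut-triangle S a b c ab bc ac
    with ≤-total (h S a) (h S c) | ≤-total (h S b) (h S c) | ≤-total (h S a) (h S b)
  ... | inj₁ a≤c | inj₁ b≤c | _        = cut-triangle-top S a b c ab bc ac a≤c b≤c
  ... | inj₁ a≤c | inj₂ c≤b | _        =
        weaken rotate (cut-triangle-top S c a b (Adj-sym ac) ab (Adj-sym bc) c≤b (≤-trans a≤c c≤b))
  ... | inj₂ c≤a | _        | inj₁ a≤b =
        weaken rotate (cut-triangle-top S c a b (Adj-sym ac) ab (Adj-sym bc) (≤-trans c≤a a≤b) a≤b)
  ... | inj₂ c≤a | _        | inj₂ b≤a =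
        weaken (rotate ∘ rotate) (cut-triangle-top S b c a bc (Adj-sym ac) (Adj-sym ab) b≤a c≤a)

  -- The component `ab` gives up its edge and also a root: if neither end were a root, each would
  -- lie strictly below the other.
  cut-lone-edge : ∀ (S : State) a b → Adj (E S) a b → (∀ {w} → Adj (E S) a w → w ≡ b) →
                  (∀ {w} → Adj (E S) b w → w ≡ a) → Step S 2 (star a)
  cut-lone-edge S a b ab only-b only-a = finish root
    where
    E′ : EdgeList
    E′ = delete a (b ∷ []) (E S)
    iso-a : ∀ {w} → ¬ Adj E′ a w
    iso-a e with refl ← only-b (delete-⊆ a (b ∷ []) e) = delete-gone a (b ∷ []) {E S} (here refl) e
    iso-b : ∀ {w} → ¬ Adj E′ b w
    iso-b e with refl ← only-a (delete-⊆ a (b ∷ []) e) = delete-gone a (b ∷ []) {E S} (here refl) (Adj-sym e)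
    rooted′ : Rooted E′ (L S) (h S)
    rooted′ e with rooted S (delete-⊆ a (b ∷ []) e)
    ... | inj₁ m = inj₁ m
    ... | inj₂ (p , up , lt) with delete-kept a (b ∷ []) up
    ...   | inj₁ up′ = inj₂ (p , up′ , lt)
    ...   | inj₂ (inj₁ (refl , _)) = contradiction e iso-a
    ...   | inj₂ (inj₂ (_ , here refl)) = contradiction e iso-b
    root : ∃ λ r → r ∈ L S × (∀ {w} → ¬ Adj E′ r w)
    root with rooted S ab | rooted S (Adj-sym ab)
    ... | inj₁ m | _ = a , m , iso-a
    ... | inj₂ _ | inj₁ m = b , m , iso-b
    ... | inj₂ (p , ap , lt) | inj₂ (q , bq , lt′)
          with refl ← only-b ap | refl ← only-a bq = contradiction lt′ (<-asym lt)
    finish : (∃ λ r → r ∈ L S × (∀ {w} → ¬ Adj E′ r w)) → Step S 2 (star a)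
    finish (r , r∈L , iso) = record
      { next = record { E = E′ ; L = without r (L S) ; h = h S
                      ; rooted = rooted-without iso rooted′ ; loopless = loopless S ∘ delete-⊆ a (b ∷ []) }
      ; sub = delete-⊆ a (b ∷ [])
      ; kept = Sum.map₂ (between⇒hit a (b ∷ [])) ∘ delete-kept a (b ∷ [])
      ; shorter = delete-≤ a (b ∷ []) (E S)
      ; bound = begin
          length E′ + l + 2     ≡⟨ +-assoc (length E′) l 2 ⟩
          length E′ + (l + 2)   ≡⟨ cong (length E′ +_) (+-comm l 2) ⟩
          length E′ + (1 + suc l) ≡⟨ +-assoc (length E′) 1 (suc l) ⟨
          length E′ + 1 + suc l ≤⟨ +-mono-≤ (delete-length a (b ∷ []) ([] ∷ []) λ { (here refl) → ab })
                                     (filter-notAll (λ u → ¬? (u ≟ r)) (L S) (lose r∈L (λ r≢r → r≢r refl))) ⟩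
          potential S           ∎ }
      where
      open ≤-Reasoning
      l : ℕ
      l = length (without r (L S))

  -- Reductions: one piece for a drop of four

  Tri : EdgeList → V → V → V → Set
  Tri E x y z = Adj E x y × Adj E y z × Adj E x z

  Hit₃ : Piece → V → V → V → Set
  Hit₃ p x y z = Hit p x y ⊎ Hit p y z ⊎ Hit p x z

  -- `cover` is about triangles, not edges: edges that the piece does not hit may be deleted too,
  -- provided the piece meets every triangle destroyed in this way.
  record Reduction (S : State) : Set where
    field
      piece : Piece
      next  : State
      shorter : length (E next) < length (E S)
      bound : potential next + 4 ≤ potential S
      cover : ∀ {x y z} → Tri (E S) x y z → Hit₃ piece x y z ⊎ Tri (E next) x y z

  kept-triangle : ∀ {S : State} {k p} (T : Step S k p) → ∀ {x y z} → Tri (E S) x y z →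
                  Hit₃ p x y z ⊎ Tri (E (next T)) x y z
  kept-triangle T (xy , yz , xz) with kept T xy | kept T yz | kept T xz
  ... | inj₂ k | _ | _ = inj₁ (inj₁ k)
  ... | inj₁ _ | inj₂ k | _ = inj₁ (inj₂ (inj₁ k))
  ... | inj₁ _ | inj₁ _ | inj₂ k = inj₁ (inj₂ (inj₂ k))
  ... | inj₁ a | inj₁ b | inj₁ c = inj₂ (a , b , c)

  reduce-one : ∀ {S : State} {k p} (T : Step S k p) → 4 ≤ k →
               length (E (next T)) < length (E S) → Reduction S
  reduce-one {p = p} T 4≤k lt = record
    { piece = p ; next = next T ; shorter = lt
    ; bound = ≤-trans (+-monoʳ-≤ (potential (next T)) 4≤k) (bound T)
    ; cover = kept-triangle T }

  -- The star of `c` is deleted without being paid for: in every triangle through `c`, the piece `p`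
  -- hits the side opposite `c` by `link`. So both gains count against a single piece.
  reduce-two : ∀ {S : State} {c p k m} (T : Step S k (star c)) (U : Step (next T) m p) → 4 ≤ m + k →
               length (E (next T)) < length (E S) →
               (∀ {y z} → Adj (E S) c y → Adj (E S) c z → Adj (E S) y z → Hit p y z) → Reduction S
  reduce-two {S} {c} {p} {k} {m} T U 4≤ lt link = record
    { piece = p ; next = next U ; shorter = ≤-<-trans (shorter U) lt
    ; bound = begin
        potential (next U) + 4       ≤⟨ +-monoʳ-≤ (potential (next U)) 4≤ ⟩
        potential (next U) + (m + k) ≡⟨ +-assoc (potential (next U)) m k ⟨
        potential (next U) + m + k   ≤⟨ +-monoˡ-≤ k (bound U) ⟩
        potential (next T) + k       ≤⟨ bound T ⟩
        potential S                  ∎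
    ; cover = cover′ }
    where
    open ≤-Reasoning
    cover′ : ∀ {x y z} → Tri (E S) x y z → Hit₃ p x y z ⊎ Tri (E (next U)) x y z
    cover′ {x} {y} {z} (xy , yz , xz) with x ≟ c | y ≟ c | z ≟ c
    ... | yes refl | _        | _        = inj₁ (inj₂ (inj₁ (link xy xz yz)))
    ... | no _     | yes refl | _        = inj₁ (inj₂ (inj₂ (link (Adj-sym xy) yz xz)))
    ... | no _     | no _     | yes refl = inj₁ (inj₁ (link (Adj-sym xz) (Adj-sym yz) xy))
    ... | no x≢c   | no y≢c   | no z≢c   =
          kept-triangle U (kept-away T x≢c y≢c xy , kept-away T y≢c z≢c yz , kept-away T x≢c z≢c xz)

  -- Case analysis at a vertex no lower than its neighbours

  module _ (S : State) (inTri : ∀ {x y} → Adj (E S) x y → ∃ λ z → Adj (E S) x z × Adj (E S) y z)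
           (c : V) (low : ∀ {w} → Adj (E S) c w → h S w ≤ h S c) where

    private
      ≢c : ∀ {x} → Adj (E S) c x → x ≢ c
      ≢c a refl = loopless S a

      -- `T` isolates `c`, and `k` will be the degree of `c`. What `k` lacks to 4 has to come from a
      -- second step in `next T`.
      module _ {k} (T : Step S k (star c)) (gone : ∀ {w} → ¬ Adj (E (next T)) c w) where

        -- The edge `ax` lies in a triangle `axy`. Here `y` is not `c`, because `x` is neither `a`
        -- nor `b` and so not a neighbour of `c`. Hence `a` still has two adjacent neighbours after
        -- `c` is gone, and `isolate` gains 2 from them.
        isolate-pair : ∀ {a b x} → (∀ {w} → Adj (E S) c w → w ≡ a ⊎ w ≡ b) → Adj (E S) c a →
                       x ≢ b → Adj (E (next T)) a x → Step (next T) 2 (star a)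
        isolate-pair {a} {b} {x} nbr ca x≢b ax with inTri (sub T ax)
        ... | y , ay , xy = isolate (next T) a x (x ∷ y ∷ []) ((x≢y ∷ []) ∷ [] ∷ [])
                (λ { (here refl) → ax ; (there (here refl)) → kept-away T (≢c ca) y≢c ay }) (here refl)
                (λ { (here refl) → inj₁ refl ; (there (here refl)) → inj₂ (Adj-sym (kept-away T x≢c y≢c xy)) })
          where
          x≢y : x ≢ y
          x≢y refl = loopless S xy
          x≢c : x ≢ c
          x≢c refl = gone (Adj-sym ax)
          y≢c : y ≢ c
          y≢c refl with nbr (Adj-sym xy)
          ... | inj₁ refl = loopless S (sub T ax)
          ... | inj₂ eq   = x≢b eq

        link-star : ∀ {a b} → (∀ {w} → Adj (E S) c w → w ≡ a ⊎ w ≡ b) →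
                    ∀ {y z} → Adj (E S) c y → Adj (E S) c z → Adj (E S) y z → Hit (star a) y z
        link-star nbr cy cz yz with nbr cy | nbr cz
        ... | inj₁ e    | _         = inj₁ e
        ... | inj₂ _    | inj₁ e    = inj₂ e
        ... | inj₂ refl | inj₂ refl = contradiction yz (loopless S)

        -- The missing 2 comes from a further triangle at `a` or at `b`. If there is none, `abc` was
        -- a component, and the edge `ab` that remains yields 2 together with its root.
        reduce-degree-two : ∀ {a b} → (∀ {w} → Adj (E S) c w → w ≡ a ⊎ w ≡ b) → Adj (E S) c a → Adj (E S) c b →
                            Adj (E S) a b → 2 ≤ k → length (E (next T)) < length (E S) → Reduction S
        reduce-degree-two {a} {b} nbr ca cb ab 2≤k lt
          with any? (λ x → ¬? (x ≟ b) ×-dec Adj? (E (next T)) a x)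
             | any? (λ x → ¬? (x ≟ a) ×-dec Adj? (E (next T)) b x)
        ... | yes (x , x≢b , ax) | _ =
              reduce-two T (isolate-pair nbr ca x≢b ax) (+-monoʳ-≤ 2 2≤k) lt (link-star nbr)
        ... | no _ | yes (x , x≢a , bx) =
              reduce-two T (isolate-pair (Sum.swap ∘ nbr) cb x≢a bx) (+-monoʳ-≤ 2 2≤k) lt
                (link-star (Sum.swap ∘ nbr))
        ... | no ¬x | no ¬y =
              reduce-two T (cut-lone-edge (next T) a b (kept-away T (≢c ca) (≢c cb) ab) (only ¬x) (only ¬y))
                (+-monoʳ-≤ 2 2≤k) lt (link-star nbr)
          where
          only : ∀ {a b} → ¬ (∃ λ x → x ≢ b × Adj (E (next T)) a x) → ∀ {w} → Adj (E (next T)) a w → w ≡ b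
          only {a} {b} ¬x {w} aw with w ≟ b
          ... | yes e  = e
          ... | no w≢b = contradiction (w , w≢b , aw) ¬x

        -- As `a` and `d` are not joined, every edge among the neighbours of `c` contains `b`, so
        -- the star of `b` meets all triangles at `c`. Only 1 is missing, and the edge `ab` supplies
        -- it.
        reduce-path : ∀ {a b d} → (∀ {w} → Adj (E S) c w → w ≡ a ⊎ w ≡ b ⊎ w ≡ d) → Adj (E S) c a → Adj (E S) c b →
                      Adj (E S) a b → ¬ Adj (E S) a d → 3 ≤ k → length (E (next T)) < length (E S) → Reduction S
        reduce-path {a} {b} {d} nbr ca cb ab ¬ad 3≤k lt =
          reduce-two T (isolate (next T) b a (a ∷ []) ([] ∷ [])
                         (λ { (here refl) → Adj-sym (kept-away T (≢c ca) (≢c cb) ab) }) (here refl)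
                         (λ { (here refl) → inj₁ refl }))
                     (+-monoʳ-≤ 1 3≤k) lt link
          where
          link : ∀ {y z} → Adj (E S) c y → Adj (E S) c z → Adj (E S) y z → Hit (star b) y z
          link cy cz yz with nbr cy | nbr cz
          ... | inj₂ (inj₁ e)    | _                = inj₁ e
          ... | inj₁ _           | inj₂ (inj₁ e)    = inj₂ e
          ... | inj₂ (inj₂ _)    | inj₂ (inj₁ e)    = inj₂ e
          ... | inj₁ refl        | inj₁ refl        = contradiction yz (loopless S)
          ... | inj₁ refl        | inj₂ (inj₂ refl) = contradiction yz ¬ad
          ... | inj₂ (inj₂ refl) | inj₁ refl        = contradiction (Adj-sym yz) ¬ad
          ... | inj₂ (inj₂ refl) | inj₂ (inj₂ refl) = contradiction yz (loopless S)

        -- Three edges among the neighbours of `c` make a triangle, two make a path. With fewer,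
        -- some neighbour is joined to neither of the others, and its edge to `c` would lie in no
        -- triangle, against `inTri`; the last three groups of clauses treat `d`, `a` and `b` in
        -- this role.
        reduce-degree-three : ∀ {a b d} → (∀ {w} → Adj (E S) c w → w ≡ a ⊎ w ≡ b ⊎ w ≡ d) →
                              Adj (E S) c a → Adj (E S) c b → Adj (E S) c d →
                              3 ≤ k → length (E (next T)) < length (E S) → Reduction S
        reduce-degree-three {a} {b} {d} nbr ca cb cd 3≤k lt
          with Adj? (E S) a b | Adj? (E S) b d | Adj? (E S) a d
        ... | yes ab | yes bd | yes ad = reduce-two T
                (cut-triangle (next T) a b d (kept-away T (≢c ca) (≢c cb) ab)
                  (kept-away T (≢c cb) (≢c cd) bd) (kept-away T (≢c ca) (≢c cd) ad))
                (+-monoʳ-≤ 1 3≤k) lt (λ cy cz _ → member (nbr cy) , member (nbr cz))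
          where
          member : ∀ {w} → w ≡ a ⊎ w ≡ b ⊎ w ≡ d → w ∈ (a ∷ b ∷ d ∷ [])
          member (inj₁ e)        = here e
          member (inj₂ (inj₁ e)) = there (here e)
          member (inj₂ (inj₂ e)) = there (there (here e))
        ... | yes ab | yes bd | no ¬ad = reduce-path nbr ca cb ab ¬ad 3≤k lt
        ... | yes ab | no ¬bd | yes ad =
              reduce-path ([ inj₂ ∘ inj₁ , [ inj₁ , inj₂ ∘ inj₂ ]′ ]′ ∘ nbr) cb ca (Adj-sym ab) ¬bd 3≤k lt
        ... | no ¬ab | yes bd | yes ad =
              reduce-path ([ inj₁ , [ inj₂ ∘ inj₂ , inj₂ ∘ inj₁ ]′ ]′ ∘ nbr) ca cd ad ¬ab 3≤k lt
        ... | _      | no ¬bd | no ¬ad with inTri cd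
        ...   | z , cz , dz with nbr cz
        ...     | inj₁ refl        = contradiction (Adj-sym dz) ¬ad
        ...     | inj₂ (inj₁ refl) = contradiction (Adj-sym dz) ¬bd
        ...     | inj₂ (inj₂ refl) = contradiction dz (loopless S)
        reduce-degree-three {a} {b} {d} nbr ca cb cd 3≤k lt | no ¬ab | _ | no ¬ad with inTri ca
        ...   | z , cz , az with nbr cz
        ...     | inj₁ refl        = contradiction az (loopless S)
        ...     | inj₂ (inj₁ refl) = contradiction az ¬ab
        ...     | inj₂ (inj₂ refl) = contradiction az ¬ad
        reduce-degree-three {a} {b} {d} nbr ca cb cd 3≤k lt | no ¬ab | no ¬bd | _ with inTri cb
        ...   | z , cz , bz with nbr cz
        ...     | inj₁ refl        = contradiction (Adj-sym bz) ¬ab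
        ...     | inj₂ (inj₁ refl) = contradiction bz (loopless S)
        ...     | inj₂ (inj₂ refl) = contradiction bz ¬bd

    reduce-at-top : ∀ {u} → Adj (E S) c u → Reduction S
    reduce-at-top cu = cases xs (neighbours-unique (E S) c) adj⁻ ∈-neighbours⁺ refl
      where
      xs : List V
      xs = neighbours (E S) c
      adj⁻ : ∀ {w} → w ∈ xs → Adj (E S) c w
      adj⁻ = ∈-neighbours⁻ {E = E S}
      T : Step S (length xs) (star c)
      T = isolate-top S c xs (neighbours-unique (E S) c) adj⁻ ∈-neighbours⁺ (low ∘ adj⁻)
      gone : ∀ {w} → ¬ Adj (E (next T)) c w
      gone a = delete-gone c xs {E S} (∈-neighbours⁺ (sub T a)) a
      nonempty : ∀ {w} {ys : List V} → w ∈ ys → 1 ≤ length ys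
      nonempty (here _)  = s≤s z≤n
      nonempty (there _) = s≤s z≤n
      lt : length (E (next T)) < length (E S)
      lt = begin-strict
        length (E (next T))             <⟨ m<m+n _ (nonempty (∈-neighbours⁺ {E = E S} cu)) ⟩
        length (E (next T)) + length xs ≤⟨ delete-length c xs (neighbours-unique (E S) c) adj⁻ ⟩
        length (E S)                    ∎
        where open ≤-Reasoning
      -- `ys` stands for `xs`; matching on a separate list leaves the type of `T`, which mentions
      -- `length xs`, untouched.
      cases : ∀ ys → Unique ys → (∀ {w} → w ∈ ys → Adj (E S) c w) → (∀ {w} → Adj (E S) c w → w ∈ ys) →
              length xs ≡ length ys → Reduction S
      cases [] _ _ adj⁺ _ with () ← adj⁺ cu
      -- A triangle on the edge `ca` would need a second neighbour of `c`.
      cases (a ∷ []) _ adj⁻ adj⁺ _ with inTri (adj⁻ (here refl))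
      ... | z , cz , az with here refl ← adj⁺ cz = contradiction az (loopless S)
      cases (a ∷ b ∷ []) _ adj⁻ adj⁺ eq =
        reduce-degree-two T gone nbr (adj⁻ (here refl)) (adj⁻ (there (here refl))) ab (≤-reflexive (≡-sym eq)) lt
        where
        nbr : ∀ {w} → Adj (E S) c w → w ≡ a ⊎ w ≡ b
        nbr cw with adj⁺ cw
        ... | here e         = inj₁ e
        ... | there (here e) = inj₂ e
        ab : Adj (E S) a b
        ab with inTri (adj⁻ (here refl))
        ... | z , cz , az with nbr cz
        ...   | inj₁ refl = contradiction az (loopless S)
        ...   | inj₂ refl = az
      cases (a ∷ b ∷ d ∷ []) _ adj⁻ adj⁺ eq =
        reduce-degree-three T gone nbr (adj⁻ (here refl)) (adj⁻ (there (here refl))) (adj⁻ (there (there (here refl))))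
          (≤-reflexive (≡-sym eq)) lt
        where
        nbr : ∀ {w} → Adj (E S) c w → w ≡ a ⊎ w ≡ b ⊎ w ≡ d
        nbr cw with adj⁺ cw
        ... | here e                 = inj₁ e
        ... | there (here e)         = inj₂ (inj₁ e)
        ... | there (there (here e)) = inj₂ (inj₂ e)
      cases (_ ∷ _ ∷ _ ∷ _ ∷ ys) _ _ _ eq =
        reduce-one T (≤-trans (s≤s (s≤s (s≤s (s≤s z≤n)))) (≤-reflexive (≡-sym eq))) lt

  -- A highest vertex and the induction

  highest : ∀ (f : V → ℕ) u us → ∃ λ t → t ∈ (u ∷ us) × (∀ {w} → w ∈ (u ∷ us) → f w ≤ f t)
  highest f u [] = u , here refl , λ { (here refl) → ≤-refl }
  highest f u (w ∷ ws) with highest f w ws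
  ... | t , t∈ , max with ≤-total (f u) (f t)
  ...   | inj₁ le = t , there t∈ , λ { (here refl) → le ; (there m) → max m }
  ...   | inj₂ ge = u , here refl , λ { (here refl) → ≤-refl ; (there m) → ≤-trans (max m) ge }

  top-vertex : ∀ (f : V → ℕ) E → (∀ {x y} → ¬ Adj E x y) ⊎
               (∃₂ λ t u → Adj E t u × (∀ {w} → Adj E t w → f w ≤ f t))
  top-vertex f [] = inj₁ λ { (inj₁ ()) ; (inj₂ ()) }
  -- The maximum is taken over the ends of edges only, so `t` has a neighbour. The first end of `e`
  -- is split off because `highest` wants a non-empty list.
  top-vertex f (e ∷ es) with highest f (proj₁ e) (map proj₁ es ++ map proj₂ (e ∷ es))
  ... | t , t∈ , max = inj₂ (t , proj₁ partner , proj₂ partner , bounded)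
    where
    bounded : ∀ {w} → Adj (e ∷ es) t w → f w ≤ f t
    bounded (inj₁ m) = max (∈-++⁺ʳ (map proj₁ (e ∷ es)) (∈-map⁺ proj₂ m))
    bounded (inj₂ m) = max (∈-++⁺ˡ (∈-map⁺ proj₁ m))
    partner : ∃ λ u → Adj (e ∷ es) t u
    partner with ∈-++⁻ (map proj₁ (e ∷ es)) t∈
    ... | inj₁ m with (_ , u) , eu , refl ← ∈-map⁻ proj₁ m = u , inj₁ eu
    ... | inj₂ m with (u , _) , eu , refl ← ∈-map⁻ proj₂ m = u , inj₂ eu

  Solution : State → Set
  Solution S = ∃ λ ps → 4 * length ps ≤ potential S ×
               (∀ {x y z} → Tri (E S) x y z → Any (λ p → Hit₃ p x y z) ps)

  solve : ∀ (S : State) → Acc _<_ (length (E S)) → Solution S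
  solve S (acc rec) with All.all? (λ (x , y) → any? λ z → Adj? (E S) x z ×-dec Adj? (E S) y z) (E S)
  -- Some edge `xy` has ends without a common neighbour. Deleting it destroys no triangle, and
  -- `cut-bound` keeps the potential from rising.
  solve S (acc rec) | no ¬all
    with (x , y) , xy∈ , ¬common ←
           find (¬All⇒Any¬ (λ (x , y) → any? λ z → Adj? (E S) x z ×-dec Adj? (E S) y z) (E S) ¬all)
    with ps , bnd , cov ← solve (cut S x (y ∷ [])) (rec (≤-trans (≤-reflexive (+-comm 1 _))
                            (delete-length x (y ∷ []) ([] ∷ []) λ { (here refl) → inj₁ xy∈ })))
    = ps , ≤-trans bnd (cut-bound S x (y ∷ [])) ,
      λ (ab , bc , ac) → cov (kept′ ab ac bc , kept′ bc (Adj-sym ab) (Adj-sym ac) , kept′ ac ab (Adj-sym bc))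
    where
    kept′ : ∀ {a b c} → Adj (E S) a b → Adj (E S) a c → Adj (E S) b c → Adj (delete x (y ∷ []) (E S)) a b
    kept′ ab ac bc with delete-kept x (y ∷ []) ab
    ... | inj₁ ab′ = ab′
    ... | inj₂ (inj₁ (refl , here refl)) = contradiction (_ , ac , bc) ¬common
    ... | inj₂ (inj₂ (refl , here refl)) = contradiction (_ , bc , ac) ¬common
  solve S (acc rec) | yes all with top-vertex (h S) (E S)
  ... | inj₁ none = [] , z≤n , λ (xy , _) → contradiction xy none
  ... | inj₂ (t , u , tu , low) = extend (reduce-at-top S inTri t low tu)
    where
    inTri : ∀ {x y} → Adj (E S) x y → ∃ λ z → Adj (E S) x z × Adj (E S) y z
    inTri (inj₁ m) = All.lookup all m
    inTri (inj₂ m) with z , yz , xz ← All.lookup all m = z , xz , yz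
    extend : Reduction S → Solution S
    extend R with solve (Reduction.next R) (rec (Reduction.shorter R))
    ... | ps , bnd , cov = Reduction.piece R ∷ ps ,
          ≤-trans (≤-reflexive (*-suc 4 (length ps)))
            (≤-trans (+-monoʳ-≤ 4 bnd) (≤-trans (≤-reflexive (+-comm 4 _)) (Reduction.bound R))) ,
          λ tr → [ here , there ∘ cov ]′ (Reduction.cover R tr)

-- The edge list of a graph

forward : ∀ G → Fin (v G) → Fin (v G) → Bool
forward G i j = (toℕ i <ᵇ toℕ j) ∧ adj G i j

-- Each edge occurs once, with its smaller end first, to agree with the way `edges` counts.
edgeList : ∀ G → EdgeList {v G}
edgeList G = concatMap (λ i → map (i ,_) (filter (λ j → forward G i j ≟ᵇ true) (allFin (v G)))) (allFin (v G))

sum-indicator : ∀ {A : Set} (f : A → Bool) ys →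
                sum (map (λ j → if f j then 1 else 0) ys) ≡ length (filter (λ j → f j ≟ᵇ true) ys)
sum-indicator f [] = refl
sum-indicator f (y ∷ ys) with f y
... | true  = cong suc (sum-indicator f ys)
... | false = sum-indicator f ys

edges≡length : ∀ G → edges G ≡ length (edgeList G)
edges≡length G = go (allFin (v G))
  where
  open ≡-Reasoning
  row : Fin (v G) → List (Fin (v G))
  row i = filter (λ j → forward G i j ≟ᵇ true) (allFin (v G))
  ind : Fin (v G) → List ℕ
  ind i = map (λ j → if forward G i j then 1 else 0) (allFin (v G))
  go : ∀ is → sum (concatMap ind is) ≡ length (concatMap (λ i → map (i ,_) (row i)) is)
  go []       = refl
  go (i ∷ is) = begin
    sum (ind i ++ concatMap ind is)                                    ≡⟨ sum-++ (ind i) _ ⟩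
    sum (ind i) + sum (concatMap ind is)                               ≡⟨ cong₂ _+_ (sum-indicator (forward G i) (allFin (v G))) (go is) ⟩
    length (row i) + length (concatMap (λ i → map (i ,_) (row i)) is)  ≡⟨ cong (_+ _) (length-map (i ,_) (row i)) ⟨
    length (map (i ,_) (row i)) + length (concatMap (λ i → map (i ,_) (row i)) is) ≡⟨ length-++ (map (i ,_) (row i)) ⟨
    length (concatMap (λ i → map (i ,_) (row i)) (i ∷ is))             ∎

forward⇒adj : ∀ G i j → forward G i j ≡ true → adj G i j ≡ true
forward⇒adj G i j eq with toℕ i <ᵇ toℕ j
... | true  = eq

adj⇒forward : ∀ G i j → toℕ i < toℕ j → adj G i j ≡ true → forward G i j ≡ true
adj⇒forward G i j lt eq = cong₂ _∧_ (Equivalence.to T-≡ (<⇒<ᵇ lt)) eq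

∈-edgeList⁻ : ∀ G {i j} → (i , j) ∈ edgeList G → adj G i j ≡ true
∈-edgeList⁻ G m with find (∈-concatMap⁻ _ {xs = allFin (v G)} m)
... | i , _ , m′ with ∈-map⁻ (i ,_) m′
...   | j , j∈ , refl = forward⇒adj G i j (proj₂ (∈-filter⁻ (λ j → forward G i j ≟ᵇ true) {xs = allFin (v G)} j∈))

∈-edgeList⁺ : ∀ G {i j} → toℕ i < toℕ j → adj G i j ≡ true → (i , j) ∈ edgeList G
∈-edgeList⁺ G {i} {j} lt a = ∈-concatMap⁺ _ (lose (∈-allFin i)
  (∈-map⁺ (i ,_) (∈-filter⁺ (λ j → forward G i j ≟ᵇ true) (∈-allFin j) (adj⇒forward G i j lt a))))

adj⇒Adj : ∀ G {i j} → adj G i j ≡ true → Adj (edgeList G) i j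
adj⇒Adj G {i} {j} a with <-cmp (toℕ i) (toℕ j)
... | tri< lt _ _ = inj₁ (∈-edgeList⁺ G lt a)
... | tri> _ _ gt = inj₂ (∈-edgeList⁺ G gt (≡-trans (sym G j i) a))
... | tri≈ _ eq _ with refl ← toℕ-injective eq with () ← ≡-trans (≡-sym a) (irrefl G i)

Adj⇒adj : ∀ G {i j} → Adj (edgeList G) i j → adj G i j ≡ true
Adj⇒adj G (inj₁ m) = ∈-edgeList⁻ G m
Adj⇒adj G {i} {j} (inj₂ m) = ≡-trans (sym G i j) (∈-edgeList⁻ G m)

-- Distances and the initial state

least : ∀ {P : ℕ → Set} → (∀ k → Dec (P k)) → ∀ k → P k → ∃ λ m → P m × (∀ {j} → P j → m ≤ j)
least P? k pk with P? 0
... | yes p0 = 0 , p0 , λ _ → z≤n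
least P? zero    pk | no ¬p0 = contradiction pk ¬p0
least P? (suc k) pk | no ¬p0 with least (P? ∘ suc) k pk
... | m , pm , min = suc m , pm , λ { {zero} p0 → contradiction p0 ¬p0 ; {suc j} pj → s≤s (min pj) }

module _ (G : Graph) where

  private
    V : Set
    V = Fin (v G)

  -- Walks of bounded length replace `Reach` because they are decidable, so that a least length can
  -- be searched for.
  Within : V → ℕ → V → Set
  Within r zero    u = u ≡ r
  Within r (suc k) u = Within r k u ⊎ ∃ λ w → adj G u w ≡ true × Within r k w

  Within? : ∀ r k u → Dec (Within r k u)
  Within? r zero    u = u ≟ r
  Within? r (suc k) u = Within? r k u ⊎-dec any? (λ w → (adj G u w ≟ᵇ true) ×-dec Within? r k w)

  reach⇒within : ∀ {u r} → Reach G u r → ∃ λ k → Within r k u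
  reach⇒within here        = 0 , refl
  reach⇒within (step a rw) with k , wk ← reach⇒within rw = suc k , inj₂ (_ , a , wk)

  -- `h` is the distance to `r`: the first step of a shortest walk to `r` leads to a vertex of
  -- smaller distance.
  distance-rooted : Connected G → ∀ r → ∃ λ h → Rooted (edgeList G) (r ∷ []) h
  distance-rooted conn r = h , rooted
    where
    dist : ∀ u → ∃ λ m → Within r m u × (∀ {j} → Within r j u → m ≤ j)
    dist u with k , wk ← reach⇒within (conn u r) = least (λ k → Within? r k u) k wk
    h : V → ℕ
    h u = proj₁ (dist u)
    rooted : Rooted (edgeList G) (r ∷ []) h
    rooted {u} _ with dist u
    ... | zero  , refl , _                  = inj₁ (here refl)
    ... | suc m , inj₁ closer , min         = contradiction (min closer) (<⇒≱ ≤-refl)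
    ... | suc m , inj₂ (w , uw , near) , _  = inj₂ (w , adj⇒Adj G uw , s≤s (proj₂ (proj₂ (dist w)) near))

  -- A graph without vertices satisfies `Connected` but offers no root; it gets the empty list,
  -- hence the inequality.
  initial : Connected G → ∃ λ S → State.E S ≡ edgeList G × length (State.L S) ≤ 1
  initial conn = [ rooted-state , empty-state ]′ (inhabited (v G))
    where
    inhabited : ∀ n → Fin n ⊎ ¬ Fin n
    inhabited zero    = inj₂ λ ()
    inhabited (suc n) = inj₁ zero
    no-loop : ∀ {x} → ¬ Adj (edgeList G) x x
    no-loop {x} a with () ← ≡-trans (≡-sym (Adj⇒adj G a)) (irrefl G x)
    rooted-state : V → ∃ λ S → State.E S ≡ edgeList G × length (State.L S) ≤ 1
    rooted-state r with h , rt ← distance-rooted conn r =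
      record { E = edgeList G ; L = r ∷ [] ; h = h ; rooted = rt ; loopless = no-loop } , refl , ≤-refl
    empty-state : ¬ V → ∃ λ S → State.E S ≡ edgeList G × length (State.L S) ≤ 1
    empty-state ¬v = record
      { E = edgeList G ; L = [] ; h = λ _ → 0
      ; rooted = λ {u} _ → contradiction u ¬v ; loopless = no-loop } , refl , z≤n

  few-pieces : Connected G → ∃ λ ps → 4 * length ps ≤ suc (edges G) ×
               (∀ {x y z} → Tri (edgeList G) x y z → Any (λ p → Hit₃ p x y z) ps)
  few-pieces conn with S , refl , L≤1 ← initial conn with ps , bnd , cov ← solve S (<-wellFounded _) =
    ps , ≤-trans bnd (≤-trans (+-monoʳ-≤ _ L≤1)
           (≤-reflexive (≡-trans (+-comm _ 1) (cong suc (≡-sym (edges≡length G)))))) , cov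

  -- Colouring the pieces red, and the lower bound

  pieceColouring : List (Piece {v G}) → Colouring G
  pieceColouring ps = record
    { col = λ i j → does (Any.any? (λ p → Hit? p i j) ps)
    ; colSym = λ i j → does-⇔ (mk⇔ (Any.map (λ {p} → Hit-sym p)) (Any.map (λ {p} → Hit-sym p)))
        (Any.any? (λ p → Hit? p i j) ps) (Any.any? (λ p → Hit? p j i) ps) }

does-true : ∀ {A : Set} (d : Dec A) → does d ≡ true → A
does-true (yes a) _ = a

does-false : ∀ {A : Set} (d : Dec A) → does d ≡ false → ¬ A
does-false (no ¬a) _ = ¬a

lookup-injective : ∀ {A : Set} {xs : List A} → Unique xs → ∀ i j → lookup xs i ≡ lookup xs j → i ≡ j
lookup-injective (_ ∷ _) zero    zero    _  = refl
lookup-injective (x∉ ∷ _) zero   (suc j) eq = contradiction eq (All.lookup x∉ (∈-lookup j))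
lookup-injective (x∉ ∷ _) (suc i) zero   eq = contradiction (≡-sym eq) (All.lookup x∉ (∈-lookup i))
lookup-injective (_ ∷ u) (suc i) (suc j) eq = cong suc (lookup-injective u i j eq)

unique-⊆-length : ∀ {A : Set} {xs ys : List A} → Unique xs → (∀ {x} → x ∈ xs → x ∈ ys) → length xs ≤ length ys
unique-⊆-length {xs = xs} {ys} uniq sub = injective⇒≤ {f = f} inj
  where
  f : Fin (length xs) → Fin (length ys)
  f i = Any.index (sub (∈-lookup i))
  inj : ∀ {i j} → f i ≡ f j → i ≡ j
  inj {i} {j} eq = lookup-injective uniq i j
    (≡-trans (lookup-index (sub (∈-lookup i))) (≡-trans (cong (lookup ys) eq) (≡-sym (lookup-index (sub (∈-lookup j))))))

-- Edges of one star share the centre, and edges inside one triangle have only three vertices for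
-- their ends.
pieces-intersect : ∀ {N} (p : Piece {N}) {x y z w} → Hit p x y → Hit p z w → ¬ Unique (x ∷ y ∷ z ∷ w ∷ [])
pieces-intersect (star c) (inj₁ refl) (inj₁ refl) ((_ ∷ ne ∷ _) ∷ _)           = ne refl
pieces-intersect (star c) (inj₁ refl) (inj₂ refl) ((_ ∷ _ ∷ ne ∷ _) ∷ _)       = ne refl
pieces-intersect (star c) (inj₂ refl) (inj₁ refl) (_ ∷ (ne ∷ _) ∷ _)           = ne refl
pieces-intersect (star c) (inj₂ refl) (inj₂ refl) (_ ∷ (_ ∷ ne ∷ _) ∷ _)       = ne refl
pieces-intersect (triangle a b c) (mx , my) (mz , mw) uniq = <-irrefl refl (unique-⊆-length uniq sub)
  where
  sub : ∀ {u} → u ∈ _ → u ∈ (a ∷ b ∷ c ∷ [])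
  sub (here refl)                         = mx
  sub (there (here refl))                 = my
  sub (there (there (here refl)))         = mz
  sub (there (there (there (here refl)))) = mw

≡ᵇ-suc : ∀ k → (k ≡ᵇ suc k) ≡ false
≡ᵇ-suc zero    = refl
≡ᵇ-suc (suc k) = ≡ᵇ-suc k

matchAdj-pair : ∀ k → matchAdj (k * 2) (suc (k * 2)) ≡ true
matchAdj-pair k = cong₂ (λ x y → x ∧ not y)
  (≡-trans (cong₂ _≡ᵇ_ (m*n/n≡m k 2) (≡-trans (+-distrib-/-∣ʳ 1 {k * 2} {2} (divides-refl k)) (m*n/n≡m k 2))) (≡ᵇ-refl k))
  (≡ᵇ-suc (k * 2))

-- Every red edge is hit by a piece. With fewer pieces than matching edges, two edges of the
-- matching are hit by the same piece, although their four ends are distinct.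
no-red-matching : ∀ G ps m → length ps < m → ¬ MonoCopy (nK₂ m) G (pieceColouring G ps) true
no-red-matching G ps m few (f , inj , mono) = clash (pigeonhole few (λ k → Any.index (hit k)))
  where
  odd-bound : ∀ (k : Fin m) → suc (toℕ k * 2) < 2 * m
  odd-bound k = ≤-trans (*-monoˡ-≤ 2 (toℕ<n k)) (≤-reflexive (*-comm m 2))
  left right : Fin m → Fin (2 * m)
  left  k = fromℕ< (<⇒≤ (odd-bound k))
  right k = fromℕ< (odd-bound k)
  toℕ-left : ∀ k → toℕ (left k) ≡ toℕ k * 2
  toℕ-left k = toℕ-fromℕ< (<⇒≤ (odd-bound k))
  toℕ-right : ∀ k → toℕ (right k) ≡ suc (toℕ k * 2)
  toℕ-right k = toℕ-fromℕ< (odd-bound k)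
  hit : ∀ k → Any (λ p → Hit p (f (left k)) (f (right k))) ps
  hit k = does-true (Any.any? _ ps) (proj₂ (mono (left k) (right k)
            (≡-trans (cong₂ matchAdj (toℕ-left k) (toℕ-right k)) (matchAdj-pair (toℕ k)))))
  apart : ∀ {i j a b} → toℕ i ≡ a → toℕ j ≡ b → a ≢ b → f i ≢ f j
  apart p q a≢b e = a≢b (≡-trans (≡-sym p) (≡-trans (cong toℕ (inj e)) q))
  parity : ∀ k l → k * 2 ≢ suc (l * 2)
  parity k l = even≢odd k l ∘ subst₂ (λ a b → a ≡ suc b) (*-comm k 2) (*-comm l 2)
  clash : ¬ (∃₂ λ k l → toℕ k < toℕ l × Any.index (hit k) ≡ Any.index (hit l))
  clash (k , l , k<l , same) = pieces-intersect (lookup ps (Any.index (hit k))) (lookup-index (hit k))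
      (subst (λ i → Hit (lookup ps i) (f (left l)) (f (right l))) (≡-sym same) (lookup-index (hit l)))
      ((apart (toℕ-left k) (toℕ-right k) (parity (toℕ k) (toℕ k)) ∷
        apart (toℕ-left k) (toℕ-left l) k≢l ∷
        apart (toℕ-left k) (toℕ-right l) (parity (toℕ k) (toℕ l)) ∷ []) ∷
       (apart (toℕ-right k) (toℕ-left l) (parity (toℕ l) (toℕ k) ∘ ≡-sym) ∷
        apart (toℕ-right k) (toℕ-right l) (k≢l ∘ suc-injective) ∷ []) ∷
       (apart (toℕ-left l) (toℕ-right l) (parity (toℕ l) (toℕ l)) ∷ []) ∷ [] ∷ [])
    where
    k≢l : toℕ k * 2 ≢ toℕ l * 2
    k≢l e = <⇒≢ k<l (*-cancelʳ-≡ (toℕ k) (toℕ l) 2 e)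

no-blue-triangle : ∀ G ps → (∀ {x y z} → Tri (edgeList G) x y z → Any (λ p → Hit₃ p x y z) ps) →
                   ¬ MonoCopy C₃ G (pieceColouring G ps) false
no-blue-triangle G ps cov (f , _ , mono)
  with find (cov (edge zero (suc zero) refl , edge (suc zero) (suc (suc zero)) refl ,
                  edge zero (suc (suc zero)) refl))
  where
  edge : ∀ i j → adj C₃ i j ≡ true → Adj (edgeList G) (f i) (f j)
  edge i j a = adj⇒Adj G (proj₁ (mono i j a))
... | p , p∈ , hit = case hit of λ where
        (inj₁ k)        → blue zero (suc zero) refl (lose p∈ k)
        (inj₂ (inj₁ k)) → blue (suc zero) (suc (suc zero)) refl (lose p∈ k)
        (inj₂ (inj₂ k)) → blue zero (suc (suc zero)) refl (lose p∈ k)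
  where
  blue : ∀ i j → adj C₃ i j ≡ true → ¬ Any (λ p → Hit p (f i) (f j)) ps
  blue i j a = does-false (Any.any? _ ps) (proj₂ (mono i j a))

lower-bound : ∀ n G → Connected G → Arrows G (nK₂ (suc n)) C₃ → 4 * suc n ∸ 1 ≤ edges G
lower-bound n G conn arr with ps , bnd , cov ← few-pieces G conn with arr (pieceColouring G ps)
... | inj₂ blue = contradiction blue (no-blue-triangle G ps cov)
-- If `edges G` were below `4 * suc n ∸ 1`, then `4 * length ps ≤ suc (edges G) < 4 * suc
-- n`, so at most `n` pieces would be in use.
... | inj₁ red  = ≮⇒≥ λ lt → no-red-matching G ps (suc n)
        (*-cancelˡ-< 4 (length ps) (suc n) (≤-<-trans bnd (s≤s lt))) red

-- The chain of triangles

-- The path 0, 1, 2, … with the chords from 3k to 3k + 2: the triangles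
-- {3k, 3k + 1, 3k + 2}, consecutive ones being joined by an edge.
up : ℕ → ℕ → Bool
up 0 1 = true
up 0 2 = true
up 1 2 = true
up 2 3 = true
up (suc (suc (suc a))) (suc (suc (suc b))) = up a b
up _ _ = false

up-irrefl : ∀ a → up a a ≡ false
up-irrefl 0 = refl
up-irrefl 1 = refl
up-irrefl 2 = refl
up-irrefl (suc (suc (suc a))) = up-irrefl a

up-suc : ∀ a → up a (suc a) ≡ true
up-suc 0 = refl
up-suc 1 = refl
up-suc 2 = refl
up-suc (suc (suc (suc a))) = up-suc a

link : ℕ → ℕ → Bool
link a b = up a b ∨ up b a

chain : ℕ → Graph
chain n = record
  { v = suc n * 3
  ; adj = λ i j → link (toℕ i) (toℕ j)
  ; sym = λ i j → ∨-comm (up (toℕ i) (toℕ j)) _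
  ; irrefl = λ i → cong₂ _∨_ (up-irrefl (toℕ i)) (up-irrefl (toℕ i)) }

module _ {G : Graph} where

  reach-trans : ∀ {x y z} → Reach G x y → Reach G y z → Reach G x z
  reach-trans here       q = q
  reach-trans (step a p) q = step a (reach-trans p q)

  reach-sym : ∀ {x y} → Reach G x y → Reach G y x
  reach-sym here                   = here
  reach-sym (step {u} {w} a p) = reach-trans (reach-sym p) (step (≡-trans (sym G w u) a) here)

-- Every vertex walks down the path to 0, one step at a time.
chain-connected : ∀ n → Connected (chain n)
chain-connected n u w = reach-trans (to-zero (toℕ u) u refl) (reach-sym (to-zero (toℕ w) w refl))
  where
  to-zero : ∀ k (u : Fin (suc n * 3)) → toℕ u ≡ k → Reach (chain n) u zero
  to-zero zero    zero _  = here
  to-zero (suc k) u    eq = step down (to-zero k (fromℕ< k<) (toℕ-fromℕ< k<))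
    where
    k< : k < suc n * 3
    k< = <⇒≤ (subst (_< suc n * 3) eq (toℕ<n u))
    down : link (toℕ u) (toℕ (fromℕ< k<)) ≡ true
    down = ≡-trans (cong₂ link eq (toℕ-fromℕ< k<))
             (≡-trans (∨-comm (up (suc k) k) _) (cong (_∨ up (suc k) k) (up-suc k)))

-- Counting the edges of the chain

sumTo : (ℕ → ℕ) → ℕ → ℕ
sumTo f zero    = 0
sumTo f (suc m) = f 0 + sumTo (f ∘ suc) m

sumTo-zero : ∀ m → sumTo (λ _ → 0) m ≡ 0
sumTo-zero zero    = refl
sumTo-zero (suc m) = sumTo-zero m

sum-tabulate : ∀ {A : Set} m (F : A → ℕ) (g : Fin m → A) f → (∀ i → F (g i) ≡ f (toℕ i)) →
               sum (map F (tabulate g)) ≡ sumTo f m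
sum-tabulate zero    F g f eq = refl
sum-tabulate (suc m) F g f eq = cong₂ _+_ (eq zero) (sum-tabulate m F (g ∘ suc) (f ∘ suc) (eq ∘ suc))

sum-concatMap : ∀ {A : Set} (F : A → List ℕ) xs → sum (concatMap F xs) ≡ sum (map (sum ∘ F) xs)
sum-concatMap F []       = refl
sum-concatMap F (x ∷ xs) = ≡-trans (sum-++ (F x) _) (cong (sum (F x) +_) (sum-concatMap F xs))

indicator : ℕ → ℕ → ℕ
indicator a b = if (a <ᵇ b) ∧ link a b then 1 else 0

count : ℕ → ℕ
count m = sumTo (λ a → sumTo (indicator a) m) m

-- A triangle is added in front; since `up` is invariant under a shift by three, the rows from 3 on
-- reduce to the old ones. The new edges are the three sides and the edge from 2 to 3, which exists
-- because of the form `suc m`. All other entries of the rows 0, 1, 2 vanish, whence `sumTo-zero`.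
count-step : ∀ m → count (3 + suc m) ≡ 4 + count (suc m)
count-step m rewrite sumTo-zero m = refl

count-chain : ∀ n → count (suc n * 3) ≡ 3 + n * 4
count-chain zero    = refl
count-chain (suc n) = ≡-trans (count-step (2 + n * 3)) (cong (4 +_) (count-chain n))

chain-edges : ∀ n → edges (chain n) ≡ 4 * suc n ∸ 1
chain-edges n = begin
  edges (chain n)
    ≡⟨ sum-concatMap (λ i → map (λ j → indicator (toℕ i) (toℕ j)) (allFin m)) (allFin m) ⟩
  sum (map (λ i → sum (map (λ j → indicator (toℕ i) (toℕ j)) (allFin m))) (allFin m))
    ≡⟨ sum-tabulate m _ id (λ a → sumTo (indicator a) m) (λ i → sum-tabulate m _ id (indicator (toℕ i)) (λ _ → refl)) ⟩
  count m            ≡⟨ count-chain n ⟩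
  3 + n * 4          ≡⟨ cong (_∸ 1) (*-comm (suc n) 4) ⟩
  4 * suc n ∸ 1      ∎
  where
  open ≡-Reasoning
  m : ℕ
  m = suc n * 3

-- Colourings of the chain

link-combine : ∀ {m} (k : Fin m) (o o′ : Fin 3) → link (toℕ (combine k o)) (toℕ (combine k o′)) ≡ link (toℕ o) (toℕ o′)
link-combine {suc m} zero    o o′ = cong₂ link (toℕ-↑ˡ o (m * 3)) (toℕ-↑ˡ o′ (m * 3))
link-combine {suc m} (suc k) o o′ = link-combine k o o′

link-triangle : ∀ (o o′ : Fin 3) → o ≢ o′ → link (toℕ o) (toℕ o′) ≡ true
link-triangle zero             zero             ne = contradiction refl ne
link-triangle zero             (suc zero)       ne = refl
link-triangle zero             (suc (suc zero)) ne = refl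
link-triangle (suc zero)       zero             ne = refl
link-triangle (suc zero)       (suc zero)       ne = contradiction refl ne
link-triangle (suc zero)       (suc (suc zero)) ne = refl
link-triangle (suc (suc zero)) zero             ne = refl
link-triangle (suc (suc zero)) (suc zero)       ne = refl
link-triangle (suc (suc zero)) (suc (suc zero)) ne = contradiction refl ne

module _ (n : ℕ) (c : Colouring (chain n)) where

  RedPair : Fin (suc n) → Fin 3 → Fin 3 → Set
  RedPair k o o′ = o ≢ o′ × col c (combine k o) (combine k o′) ≡ true

  redPair? : ∀ k o o′ → Dec (RedPair k o o′)
  redPair? k o o′ = ¬? (o ≟ o′) ×-dec (col c (combine k o) (combine k o′) ≟ᵇ true)

  blue-triangle : ∀ k → ¬ (∃₂ (RedPair k)) → MonoCopy C₃ (chain n) c false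
  blue-triangle k ¬red = combine k , (λ {i} {j} → combine-injectiveʳ k i k j) , λ i j a →
    let i≢j = λ { refl → contradiction (≡-trans (≡-sym a) (irrefl C₃ i)) λ () } in
    ≡-trans (link-combine k i j) (link-triangle i j i≢j) , ¬-not (λ red → ¬red (i , j , i≢j , red))

  -- The vertex `2k + s` of the matching goes to end `s` of the red edge chosen in triangle `k`.
  -- Distinct triangles are disjoint, so these edges form a matching.
  red-matching : (∀ k → ∃₂ (RedPair k)) → MonoCopy (nK₂ (suc n)) (chain n) c true
  red-matching red = f , f-injective , f-edge
    where
    bound : ∀ (i : Fin (2 * suc n)) → toℕ i < suc n * 2
    bound i = subst (toℕ i <_) (*-comm 2 (suc n)) (toℕ<n i)
    block : Fin (2 * suc n) → Fin (suc n)
    block i = fromℕ< (m<n*o⇒m/o<n {toℕ i} {suc n} {2} (bound i))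
    side : Fin (2 * suc n) → Fin 2
    side i = toℕ i mod 2
    end : Fin (suc n) → Fin 2 → Fin 3
    end k zero       = proj₁ (red k)
    end k (suc zero) = proj₁ (proj₂ (red k))
    end-red : ∀ k s s′ → s ≢ s′ → RedPair k (end k s) (end k s′)
    end-red k zero       zero       ne = contradiction refl ne
    end-red k zero       (suc zero) ne = proj₂ (proj₂ (red k))
    end-red k (suc zero) zero       ne with o≢ , r ← proj₂ (proj₂ (red k)) = o≢ ∘ ≡-sym , ≡-trans (colSym c _ _) r
    end-red k (suc zero) (suc zero) ne = contradiction refl ne
    end-injective : ∀ k s s′ → end k s ≡ end k s′ → s ≡ s′
    end-injective k s s′ eq with s ≟ s′
    ... | yes e = e
    ... | no ne = contradiction eq (proj₁ (end-red k s s′ ne))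
    f : Fin (2 * suc n) → Fin (suc n * 3)
    f i = combine (block i) (end (block i) (side i))
    digits : ∀ i j → toℕ i / 2 ≡ toℕ j / 2 → side i ≡ side j → i ≡ j
    digits i j q s = toℕ-injective (begin
      toℕ i                         ≡⟨ m≡m%n+[m/n]*n (toℕ i) 2 ⟩
      toℕ i % 2 + toℕ i / 2 * 2     ≡⟨ cong₂ (λ r q → r + q * 2) (fromℕ<-injective _ _ (m%n<n (toℕ i) 2) (m%n<n (toℕ j) 2) s) q ⟩
      toℕ j % 2 + toℕ j / 2 * 2     ≡⟨ m≡m%n+[m/n]*n (toℕ j) 2 ⟨
      toℕ j                         ∎)
      where open ≡-Reasoning
    f-injective : ∀ {i j} → f i ≡ f j → i ≡ j
    f-injective {i} {j} eq = digits i j (fromℕ<-injective _ _ _ _ blocks)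
        (end-injective (block j) _ _ (combine-injectiveʳ (block j) _ (block j) _
          (subst (λ b → combine b (end b (side i)) ≡ f j) blocks eq)))
      where
      blocks : block i ≡ block j
      blocks = combine-injectiveˡ (block i) _ (block j) _ eq
    f-edge : ∀ i j → matchAdj (toℕ i) (toℕ j) ≡ true →
             link (toℕ (f i)) (toℕ (f j)) ≡ true × col c (f i) (f j) ≡ true
    f-edge i j a with toℕ i / 2 ≡ᵇ toℕ j / 2 in quot
    -- Matched vertices have equal quotients, hence lie in the same block. The `subst` trades
    -- `block i` for `block j`, so that it suffices to treat both ends of one red edge.
    ... | true with quotients ← ≡ᵇ⇒≡ (toℕ i / 2) (toℕ j / 2) (Equivalence.from T-≡ quot)
      with blocks ← fromℕ<-cong _ _ quotients (m<n*o⇒m/o<n {toℕ i} {suc n} {2} (bound i)) (m<n*o⇒m/o<n {toℕ j} {suc n} {2} (bound j))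
      = subst (λ b → link (toℕ (f i)) (toℕ (g b)) ≡ true × col c (f i) (g b) ≡ true) blocks
          (≡-trans (link-combine (block i) _ _) (link-triangle _ _ (proj₁ pair)) , proj₂ pair)
      where
      g : Fin (suc n) → Fin (suc n * 3)
      g b = combine b (end b (side j))
      -- With equal sides `i` and `j` would coincide, which the second factor of `matchAdj`
      -- excludes.
      distinct : side i ≢ side j
      distinct s with refl ← digits i j quotients s =
        contradiction (≡-trans (≡-sym a) (cong not (≡ᵇ-refl (toℕ i)))) λ ()
      pair : RedPair (block i) (end (block i) (side i)) (end (block i) (side j))
      pair = end-red (block i) (side i) (side j) distinct

  chain-arrows : MonoCopy (nK₂ (suc n)) (chain n) c true ⊎ MonoCopy C₃ (chain n) c false
  chain-arrows with all? (λ k → any? λ o → any? (redPair? k o))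
  -- Either each of the `suc n` triangles has a red edge, or one of them is entirely blue.
  ... | yes red = inj₁ (red-matching red)
  ... | no ¬red with k , ¬pair ← ¬∀⟶∃¬ _ _ (λ k → any? λ o → any? (redPair? k o)) ¬red = inj₂ (blue-triangle k ¬pair)

theorem4 : (n : ℕ) → ConnSizeRamsey (nK₂ (suc n)) C₃ (4 * suc n ∸ 1)
theorem4 n = (chain n , chain-connected n , chain-arrows n , chain-edges n) , lower-bound n
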